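{- Fix an integer $r\ge1$. For each $n$ let $X$ be a random subcomplex of the standard simplex $\Delta_n$ on the vertex set $\{1,\dots,n\}$ with distribution $\mathbb P(X)=2^{ -H(X)}$, $H(X)=|F(X)|+|E(X)|$. Then the probability that $X$ is $r$-ample tends to $1$ as $n\to\infty$.
   Context: A subcomplex $X\subseteq\Delta_n$ is any simplicial complex whose simplexes are nonempty subsets of $\{1,\dots,n\}$. $F(X)$ is the set of simplexes of $X$; $E(X)$ is the set of simplexes $\sigma$ of $\Delta_n$ with $\sigma\notin X$ but all proper nonempty faces of $\sigma$ in $X$. $\mathbb P(X)=2^{ -H(X)}$ is a probability measure on subcomplexes of $\Delta_n$. For $U\subseteq V(X)$, $X_U$ is the induced subcomplex on $U$; $\mathrm{Lk}_X(v)$ is the subcomplex of simplexes $\sigma$ with $v\notin\sigma$, $\sigma\cup\{v\}\in X$. A nonempty simplicial complex $X$ is $r$-ample if for every $U\subseteq V(X)$ with $|U|\le r$ and every subcomplex $A\subseteq X_U$ (possibly empty) there exists $v\in V(X)\setminus U$ with $\mathrm{Lk}_X(v)\cap X_U=A$. -}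

module Defs where

open import Data.Bool using (Bool; true; false; _∧_; _∨_; not; if_then_else_)
open import Data.Nat using (ℕ; zero; suc; _+_; _≤_)
open import Data.Fin using (Fin)
open import Data.Fin.Subset using (Subset; _⊆_; _⊂_; _∈_; _∉_; _∪_; ⁅_⁆; ∣_∣; Nonempty)
open import Data.Vec.Properties using (≡-dec)
import Data.Bool as B
open import Data.Vec using (Vec; []; _∷_)
open import Data.List using (List; []; _∷_; map; _++_; concatMap; filter; length; foldr)
open import Data.Product using (Σ; _×_; _,_; ∃-syntax)
open import Data.Rational using (ℚ; ½; 1ℚ; 0ℚ) renaming (_*_ to _*ℚ_; _+_ to _+ℚ_)
open import Relation.Nullary using (does; ¬_)
open import Relation.Binary.PropositionalEquality using (_≡_)
open import Function.Bundles using (_⇔_)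

-- Simplexes of Δₙ are nonempty subsets of the vertex set Fin n
-- (Fin n stands for {1,…,n}).  A "family" of simplexes is a Boolean
-- predicate on subsets; only its values on nonempty subsets matter.

Family : ℕ → Set
Family n = Subset n → Bool

_∈F_ : ∀ {n} → Subset n → Family n → Set
σ ∈F X = X σ ≡ true

IsComplex : ∀ {n} → Family n → Set
IsComplex {n} X = ∀ (σ τ : Subset n) → Nonempty τ → τ ⊆ σ → σ ∈F X → τ ∈F X

allSubsets : ∀ n → List (Subset n)
allSubsets zero    = [] ∷ []
allSubsets (suc n) = map (false ∷_) (allSubsets n) ++ map (true ∷_) (allSubsets n)

nonemptyᵇ : ∀ {n} → Subset n → Bool
nonemptyᵇ []       = false
nonemptyᵇ (b ∷ σ)  = b ∨ nonemptyᵇ σ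

⊆ᵇ : ∀ {n} → Subset n → Subset n → Bool
⊆ᵇ []      []      = true
⊆ᵇ (a ∷ σ) (b ∷ τ) = (not a ∨ b) ∧ ⊆ᵇ σ τ

≡ᵇ : ∀ {n} → Subset n → Subset n → Bool
≡ᵇ σ τ = does (≡-dec B._≟_ σ τ)

simplexes : ∀ n → List (Subset n)
simplexes n = filter (λ σ → nonemptyᵇ σ Data.Bool.≟ true) (allSubsets n)
  where import Data.Bool

-- all families of simplexes: every Boolean function on the simplexes of
-- Δₙ occurs exactly once (taking value false on the empty set)
familiesOn : ∀ {n} → List (Subset n) → List (Family n)
familiesOn []       = (λ _ → false) ∷ []
familiesOn (s ∷ ss) =
  concatMap (λ f → f ∷ (λ t → if ≡ᵇ t s then true else f t) ∷ [])
            (familiesOn ss)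

allFamilies : ∀ n → List (Family n)
allFamilies n = familiesOn (simplexes n)

allᵇ : ∀ {A : Set} → (A → Bool) → List A → Bool
allᵇ p = foldr (λ x b → p x ∧ b) true

count : ∀ {A : Set} → (A → Bool) → List A → ℕ
count p xs = length (filter (λ x → p x Data.Bool.≟ true) xs)
  where import Data.Bool

Fcount : ∀ {n} → Family n → ℕ
Fcount {n} X = count X (simplexes n)

isMinimalNonFace : ∀ {n} → Family n → Subset n → Bool
isMinimalNonFace {n} X σ =
  not (X σ) ∧ allᵇ (λ τ → not (⊆ᵇ τ σ ∧ not (≡ᵇ τ σ)) ∨ X τ) (simplexes n)

Ecount : ∀ {n} → Family n → ℕ
Ecount {n} X = count (isMinimalNonFace X) (simplexes n)

H : ∀ {n} → Family n → ℕ
H X = Fcount X + Ecount X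

half^ : ℕ → ℚ
half^ zero    = 1ℚ
half^ (suc k) = ½ *ℚ half^ k

weight : ∀ {n} → Family n → ℚ
weight X = half^ (H X)

sumℚ : List ℚ → ℚ
sumℚ = foldr _+ℚ_ 0ℚ

_∈V_ : ∀ {n} → Fin n → Family n → Set
v ∈V X = ⁅ v ⁆ ∈F X

_∈Ind[_,_] : ∀ {n} → Subset n → Family n → Subset n → Set
σ ∈Ind[ X , U ] = (σ ∈F X) × (σ ⊆ U)

_∈Lk[_,_] : ∀ {n} → Subset n → Family n → Fin n → Set
σ ∈Lk[ X , v ] = (v ∉ σ) × ((σ ∪ ⁅ v ⁆) ∈F X)

NonemptyComplex : ∀ {n} → Family n → Set
NonemptyComplex X = IsComplex X × ∃[ σ ] (Nonempty σ × σ ∈F X)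

IsAmple : ∀ {n} → ℕ → Family n → Set
IsAmple {n} r X =
  NonemptyComplex X ×
  (∀ (U : Subset n) → (∀ u → u ∈ U → u ∈V X) → ∣ U ∣ ≤ r →
   ∀ (A : Family n) → IsComplex A →
   (∀ σ → Nonempty σ → σ ∈F A → σ ∈Ind[ X , U ]) →
   ∃[ v ] ((v ∈V X) × (v ∉ U) ×
     (∀ σ → Nonempty σ → ((σ ∈Lk[ X , v ] × σ ∈Ind[ X , U ]) ⇔ σ ∈F A))))

{-# OPTIONS --safe #-}
module Submission where

-- Toss an independent fair coin ω(σ) for every simplex σ and let core ω be the largest complex
-- all of whose simplexes show heads.  The event core ω = X prescribes exactly the coins on
-- F(X) (heads) and on E(X) (tails), so core ω has distribution 2^(-H).  Given U and a pattern A of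
-- simplexes in U, call v ∉ U a cone point for (U , A) if {v} shows heads and, for every nonempty
-- σ ⊆ U, σ ∪ {v} shows heads precisely when σ ∈ A; if A is a subcomplex of core ω, the link of v
-- then meets U in A.  A given v fails with probability at most 1 - δ, where δ = 2^(-2^r), and
-- distinct v look at disjoint coins.  With θ = δ/2, summing (1 - δ)^(n - |U|) over |U| ≤ r gives at
-- most θ^(-r) (1 - δ + θ)^n = θ^(-r) (1 - θ)^n, and there are at most 1/δ patterns per U, so the
-- failure probability tends to 0 by Bernoulli's inequality.

open import Defs
open import Data.Nat using (ℕ; _≤_)
open import Data.Product using (_×_; ∃-syntax)
open import Data.List using (map)
open import Data.List.Relation.Unary.All using (All)
open import Data.List.Relation.Binary.Sublist.Propositional using (_⊆_)
open import Data.Rational using (ℚ; Positive; 1ℚ; _-_) renaming (_≤_ to _≤ℚ_)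

open import Algebra.Bundles using (CommutativeRing)
import Algebra.Properties.Semiring.Exp as Exp
open import Data.Bool as Bool using (Bool; true; false; not; _∧_; _∨_; if_then_else_)
open import Data.Bool.Properties using (∨-identityʳ; not-involutive; ¬-not)
open import Data.Empty using (⊥-elim)
open import Data.Fin using (Fin; zero; suc)
open import Data.Fin.Properties using (suc-injective)
open import Data.Fin.Subset as Subset using (Subset; Nonempty; _∈_; _∉_; _∪_; ⁅_⁆; ⊥; ⊤; ∣_∣)
  renaming (_⊆_ to _⊆ₛ_)
open import Data.Fin.Subset.Properties as Subsetₚ using (_∈?_)
open import Data.Integer as ℤ using (+_)
import Data.Integer.Properties as ℤₚ
open import Data.List using (List; []; _∷_; _++_; length; filter; concatMap)
open import Data.List.Membership.Propositional using (lose) renaming (_∈_ to _∈ₗ_; _∉_ to _∉ₗ_)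
open import Data.List.Membership.Propositional.Properties
  using (∈-map⁺; ∈-map⁻; ∈-++⁺ˡ; ∈-++⁺ʳ; ∈-++⁻; ∈-filter⁺; ∈-filter⁻; ∈-concatMap⁺)
open import Data.List.Properties using (length-map; length-++; map-++)
open import Data.List.Relation.Binary.Sublist.Propositional.Properties using (filter-⊆)
open import Data.List.Relation.Unary.All as All using ([]; _∷_)
open import Data.List.Relation.Unary.All.Properties using (all-filter)
open import Data.List.Relation.Unary.Any as Any using (Any; here; there)
open import Data.List.Relation.Unary.Unique.Propositional using (Unique; []; _∷_)
import Data.List.Relation.Unary.Unique.Propositional.Properties as Uniqueₚ
open import Data.Nat as ℕ using (zero; suc; z≤n; s≤s)
import Data.Nat.Properties as ℕₚ
open import Data.Product using (_,_; proj₁; proj₂)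
open import Data.Rational using (0ℚ; ½; _+_; _*_; -_; _/_; mkℚ; toℚᵘ; nonNegative; *≤*)
import Data.Rational.Unnormalised as ℚᵘ
import Data.Rational.Unnormalised.Properties as ℚᵘₚ
open import Data.Rational.Properties as ℚₚ using (≤-refl; ≤-trans; ≤-reflexive; module ≤-Reasoning)
open import Data.Rational.Solver using (module +-*-Solver)
open import Data.Sum using (inj₁; inj₂)
open import Data.Vec using ([]; _∷_; here; there)
open import Data.Vec.Properties using (≡-dec; ∷-injectiveʳ)
open import Function using (_∘_; id)
open import Function.Bundles using (_⇔_; mk⇔)
open import Relation.Binary.PropositionalEquality
open import Relation.Nullary using (Dec; yes; no; ¬_; does)
open import Relation.Nullary.Decidable using (dec-true; dec-false; _×-dec_)
open import Relation.Unary using (Decidable; ∁)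

open +-*-Solver using (solve; _:+_; _:*_; _:-_; _:=_; con)
open Exp (CommutativeRing.semiring ℚₚ.+-*-commutativeRing) using (_^_)

private
  variable
    n : ℕ
    A : Set

_≟ₛ_ : (σ τ : Subset n) → Dec (σ ≡ τ)
_≟ₛ_ = ≡-dec Bool._≟_

-- Rational inequalities

0≤1 : 0ℚ ≤ℚ 1ℚ
0≤1 = *≤* (ℤ.+≤+ z≤n)

0≤½ : 0ℚ ≤ℚ ½
0≤½ = *≤* (ℤ.+≤+ z≤n)

½≤1 : ½ ≤ℚ 1ℚ
½≤1 = *≤* (ℤ.+≤+ (s≤s z≤n))

*-monoˡ : ∀ {x y z} → 0ℚ ≤ℚ x → y ≤ℚ z → x * y ≤ℚ x * z
*-monoˡ {x} 0≤x = ℚₚ.*-monoˡ-≤-nonNeg x ⦃ nonNegative 0≤x ⦄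

*-monoʳ : ∀ {x y z} → 0ℚ ≤ℚ x → y ≤ℚ z → y * x ≤ℚ z * x
*-monoʳ {x} 0≤x = ℚₚ.*-monoʳ-≤-nonNeg x ⦃ nonNegative 0≤x ⦄

*-nonNeg : ∀ {x y} → 0ℚ ≤ℚ x → 0ℚ ≤ℚ y → 0ℚ ≤ℚ x * y
*-nonNeg {x} {y} 0≤x 0≤y = subst (_≤ℚ x * y) (ℚₚ.*-zeroʳ x) (*-monoˡ 0≤x 0≤y)

+-nonNeg : ∀ {x y} → 0ℚ ≤ℚ x → 0ℚ ≤ℚ y → 0ℚ ≤ℚ x + y
+-nonNeg = ℚₚ.+-mono-≤

*-contractʳ : ∀ {x y} → 0ℚ ≤ℚ x → y ≤ℚ 1ℚ → x * y ≤ℚ x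
*-contractʳ {x} 0≤x y≤1 = ≤-trans (*-monoˡ 0≤x y≤1) (≤-reflexive (ℚₚ.*-identityʳ x))

^-nonNeg : ∀ {x} → 0ℚ ≤ℚ x → ∀ k → 0ℚ ≤ℚ x ^ k
^-nonNeg 0≤x zero    = 0≤1
^-nonNeg 0≤x (suc k) = *-nonNeg 0≤x (^-nonNeg 0≤x k)

^-≤1 : ∀ {x} → 0ℚ ≤ℚ x → x ≤ℚ 1ℚ → ∀ k → x ^ k ≤ℚ 1ℚ
^-≤1 0≤x x≤1 zero    = ≤-refl
^-≤1 0≤x x≤1 (suc k) = ≤-trans (*-contractʳ 0≤x (^-≤1 0≤x x≤1 k)) x≤1

x≤y⇒0≤y-x : ∀ {x y} → x ≤ℚ y → 0ℚ ≤ℚ y - x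
x≤y⇒0≤y-x {x} {y} x≤y = subst (_≤ℚ y - x) (ℚₚ.+-inverseʳ x) (ℚₚ.+-monoˡ-≤ (- x) x≤y)

half^-pos : ∀ k → Positive (half^ k)
half^-pos zero    = _
half^-pos (suc k) = ℚₚ.pos*pos⇒pos ½ (half^ k) ⦃ half^-pos k ⦄

half^-nonNeg : ∀ k → 0ℚ ≤ℚ half^ k
half^-nonNeg k = ℚₚ.<⇒≤ (ℚₚ.positive⁻¹ (half^ k) ⦃ half^-pos k ⦄)

half^-≤1 : ∀ k → half^ k ≤ℚ 1ℚ
half^-≤1 zero    = ≤-refl
half^-≤1 (suc k) = ≤-trans (*-contractʳ {½} 0≤½ (half^-≤1 k)) ½≤1

half^-antimono : ∀ {k l} → k ℕ.≤ l → half^ l ≤ℚ half^ k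
half^-antimono {l = l} z≤n = half^-≤1 l
half^-antimono (s≤s k≤l)   = *-monoˡ {½} 0≤½ (half^-antimono k≤l)

-- Archimedean property, Bernoulli's inequality and geometric decay

fromℕ : ℕ → ℚ
fromℕ m = + m / 1

toℚᵘ-fromℕ : ∀ m → toℚᵘ (fromℕ m) ℚᵘ.≃ (+ m ℚᵘ./ 1)
toℚᵘ-fromℕ m = ℚₚ.toℚᵘ-fromℚᵘ (+ m ℚᵘ./ 1)

-- `_/_` normalises by a gcd that does not compute for a variable `m`, so the identity is verified
-- in the unnormalised rationals, where it is integer arithmetic.
fromℕ-suc : ∀ m → fromℕ (suc m) ≡ 1ℚ + fromℕ m
fromℕ-suc m = ℚₚ.toℚᵘ-injective (begin
  toℚᵘ (fromℕ (suc m))          ≈⟨ toℚᵘ-fromℕ (suc m) ⟩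
  + suc m ℚᵘ./ 1                ≈⟨ ℚᵘ.*≡* (cong (λ z → (+ 1 ℤ.+ z) ℤ.* + 1) (sym (ℤₚ.*-identityʳ (+ m)))) ⟩
  ℚᵘ.1ℚᵘ ℚᵘ.+ (+ m ℚᵘ./ 1)      ≈⟨ ℚᵘₚ.+-congʳ ℚᵘ.1ℚᵘ (ℚᵘₚ.≃-sym (toℚᵘ-fromℕ m)) ⟩
  toℚᵘ 1ℚ ℚᵘ.+ toℚᵘ (fromℕ m)   ≈⟨ ℚᵘₚ.≃-sym (ℚₚ.toℚᵘ-homo-+ 1ℚ (fromℕ m)) ⟩
  toℚᵘ (1ℚ + fromℕ m)           ∎)
  where open import Relation.Binary.Reasoning.Setoid ℚᵘₚ.≃-setoid

fromℕ-nonNeg : ∀ m → 0ℚ ≤ℚ fromℕ m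
fromℕ-nonNeg zero    = ≤-refl
fromℕ-nonNeg (suc m) = subst (0ℚ ≤ℚ_) (sym (fromℕ-suc m)) (+-nonNeg 0≤1 (fromℕ-nonNeg m))

fromℕ-mono : ∀ {k l} → k ℕ.≤ l → fromℕ k ≤ℚ fromℕ l
fromℕ-mono {l = l} z≤n = fromℕ-nonNeg l
fromℕ-mono {suc k} {suc l} (s≤s k≤l) =
  subst₂ _≤ℚ_ (sym (fromℕ-suc k)) (sym (fromℕ-suc l)) (ℚₚ.+-monoʳ-≤ 1ℚ (fromℕ-mono k≤l))

archimedean : ∀ x → Positive x → ∃[ m ] 1ℚ ≤ℚ fromℕ m * x
-- The witness `suc d` is the denominator of `x`; multiplying by it leaves the numerator `suc a`,
-- which is at least 1.
archimedean x@(mkℚ (+ suc a) d _) _ = suc d , ℚₚ.toℚᵘ-cancel-≤ (begin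
  ℚᵘ.1ℚᵘ                            ≤⟨ ℚᵘ.*≤* (ℤ.+≤+ 1*[1*d]≤) ⟩
  (+ suc d ℚᵘ./ 1) ℚᵘ.* toℚᵘ x       ≃⟨ ℚᵘₚ.*-congʳ (ℚᵘₚ.≃-sym (toℚᵘ-fromℕ (suc d))) ⟩
  toℚᵘ (fromℕ (suc d)) ℚᵘ.* toℚᵘ x   ≃⟨ ℚᵘₚ.≃-sym (ℚₚ.toℚᵘ-homo-* (fromℕ (suc d)) x) ⟩
  toℚᵘ (fromℕ (suc d) * x)           ∎)
  where
  open ℚᵘₚ.≤-Reasoning
  1*[1*d]≤ : 1 ℕ.* (1 ℕ.* suc d) ≤ suc d ℕ.* suc a ℕ.* 1
  1*[1*d]≤ = subst₂ _≤_ (sym (trans (ℕₚ.*-identityˡ _) (ℕₚ.*-identityˡ _))) (sym (ℕₚ.*-identityʳ _))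
    (ℕₚ.m≤m*n (suc d) (suc a))

-- A division-free form of `(1 - x) ^ m ≤ 1 / (1 + m x)`. In the induction one more factor gives `(1
-- - x) (1 + (m + 1) x) = 1 + m x - (m + 1) x²`, and the last term only helps.
bernoulli : ∀ {x} → 0ℚ ≤ℚ x → x ≤ℚ 1ℚ → ∀ m → (1ℚ - x) ^ m * (1ℚ + fromℕ m * x) ≤ℚ 1ℚ
bernoulli {x} 0≤x x≤1 zero = ≤-reflexive
  (solve 1 (λ x → con 1ℚ :* (con 1ℚ :+ con 0ℚ :* x) := con 1ℚ) refl x)
bernoulli {x} 0≤x x≤1 (suc m) = begin
  (1ℚ - x) * y * (1ℚ + fromℕ (suc m) * x)         ≡⟨ cong (λ z → (1ℚ - x) * y * (1ℚ + z * x)) (fromℕ-suc m) ⟩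
  (1ℚ - x) * y * (1ℚ + (1ℚ + fromℕ m) * x)        ≡⟨ solve 3 (λ x y z →
      (con 1ℚ :- x) :* y :* (con 1ℚ :+ (con 1ℚ :+ z) :* x)
      := y :* (con 1ℚ :+ z :* x) :- y :* ((con 1ℚ :+ z) :* (x :* x))) refl x y (fromℕ m) ⟩
  y * (1ℚ + fromℕ m * x) - y * ((1ℚ + fromℕ m) * (x * x))  ≤⟨ ℚₚ.+-monoʳ-≤ (y * (1ℚ + fromℕ m * x)) (ℚₚ.neg-antimono-≤ 0≤rest) ⟩
  y * (1ℚ + fromℕ m * x) + 0ℚ                     ≡⟨ ℚₚ.+-identityʳ _ ⟩
  y * (1ℚ + fromℕ m * x)                          ≤⟨ bernoulli 0≤x x≤1 m ⟩
  1ℚ                                              ∎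
  where
  open ≤-Reasoning
  y = (1ℚ - x) ^ m
  0≤rest : 0ℚ ≤ℚ y * ((1ℚ + fromℕ m) * (x * x))
  0≤rest = *-nonNeg (^-nonNeg (x≤y⇒0≤y-x x≤1) m)
    (*-nonNeg (+-nonNeg 0≤1 (fromℕ-nonNeg m)) (*-nonNeg 0≤x 0≤x))

geometric-decay : ∀ x → Positive x → x ≤ℚ 1ℚ → ∀ η → Positive η →
                  ∃[ N ] (∀ m → N ≤ m → (1ℚ - x) ^ m ≤ℚ η)
geometric-decay x x>0 x≤1 η η>0 = N , bound
  where
  0≤x = ℚₚ.<⇒≤ (ℚₚ.positive⁻¹ x ⦃ x>0 ⦄)
  0≤η = ℚₚ.<⇒≤ (ℚₚ.positive⁻¹ η ⦃ η>0 ⦄)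
  N,1≤Nxη = archimedean (x * η) (ℚₚ.pos*pos⇒pos x ⦃ x>0 ⦄ η ⦃ η>0 ⦄)
  N = proj₁ N,1≤Nxη
  bound : ∀ m → N ≤ m → (1ℚ - x) ^ m ≤ℚ η
  bound m N≤m = begin
    y
      ≡⟨ sym (ℚₚ.*-identityʳ y) ⟩
    y * 1ℚ
      -- `N` is chosen with `N x η ≥ 1`, so inserting the factor `m x η` can only increase `y`.
      -- Writing `m x` as `(1 + m x) - 1` then gives the shape that `bernoulli` bounds.
      ≤⟨ *-monoˡ 0≤y (≤-trans (proj₂ N,1≤Nxη) (*-monoʳ (*-nonNeg 0≤x 0≤η) (fromℕ-mono N≤m))) ⟩
    y * (fromℕ m * (x * η))
      ≡⟨ solve 4 (λ y m x η → y :* (m :* (x :* η)) := η :* (y :* (con 1ℚ :+ m :* x)) :- η :* y)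
           refl y (fromℕ m) x η ⟩
    η * (y * (1ℚ + fromℕ m * x)) - η * y
      ≤⟨ ℚₚ.+-mono-≤ (*-contractʳ 0≤η (bernoulli 0≤x x≤1 m)) (ℚₚ.neg-antimono-≤ (*-nonNeg 0≤η 0≤y)) ⟩
    η + 0ℚ
      ≡⟨ ℚₚ.+-identityʳ η ⟩
    η ∎
    where
    open ≤-Reasoning
    y = (1ℚ - x) ^ m
    0≤y = ^-nonNeg (x≤y⇒0≤y-x x≤1) m

-- Finite sums and indicators

sumℚ-nonNeg : (f : A → ℚ) → (∀ a → 0ℚ ≤ℚ f a) → ∀ xs → 0ℚ ≤ℚ sumℚ (map f xs)
sumℚ-nonNeg f 0≤f []       = ≤-refl
sumℚ-nonNeg f 0≤f (x ∷ xs) = +-nonNeg (0≤f x) (sumℚ-nonNeg f 0≤f xs)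

sumℚ-mono : ∀ (f g : A → ℚ) xs → All (λ x → f x ≤ℚ g x) xs → sumℚ (map f xs) ≤ℚ sumℚ (map g xs)
sumℚ-mono f g []       []         = ≤-refl
sumℚ-mono f g (x ∷ xs) (le ∷ les) = ℚₚ.+-mono-≤ le (sumℚ-mono f g xs les)

sumℚ-++ : ∀ xs ys → sumℚ (xs ++ ys) ≡ sumℚ xs + sumℚ ys
sumℚ-++ []       ys = sym (ℚₚ.+-identityˡ _)
sumℚ-++ (x ∷ xs) ys = trans (cong (_+_ x) (sumℚ-++ xs ys)) (sym (ℚₚ.+-assoc x _ _))

sumℚ-*ˡ : ∀ c (f : A → ℚ) xs → sumℚ (map (λ x → c * f x) xs) ≡ c * sumℚ (map f xs)
sumℚ-*ˡ c f []       = sym (ℚₚ.*-zeroʳ c)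
sumℚ-*ˡ c f (x ∷ xs) = trans (cong (_+_ (c * f x)) (sumℚ-*ˡ c f xs)) (sym (ℚₚ.*-distribˡ-+ c _ _))

member≤sumℚ : (f : A → ℚ) → (∀ a → 0ℚ ≤ℚ f a) → ∀ {x xs} → x ∈ₗ xs → f x ≤ℚ sumℚ (map f xs)
member≤sumℚ f 0≤f {x} {_ ∷ xs} (here refl) =
  subst (_≤ℚ f x + sumℚ (map f xs)) (ℚₚ.+-identityʳ (f x)) (ℚₚ.+-monoʳ-≤ (f x) (sumℚ-nonNeg f 0≤f xs))
member≤sumℚ f 0≤f {x} {y ∷ xs} (there x∈xs) =
  subst (_≤ℚ f y + sumℚ (map f xs)) (ℚₚ.+-identityˡ (f x)) (ℚₚ.+-mono-≤ (0≤f y) (member≤sumℚ f 0≤f x∈xs))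

𝟙 : Bool → ℚ
𝟙 b = if b then 1ℚ else 0ℚ

𝟙-nonNeg : ∀ b → 0ℚ ≤ℚ 𝟙 b
𝟙-nonNeg true  = 0≤1
𝟙-nonNeg false = ≤-refl

𝟙-∧ : ∀ a b → 𝟙 (a ∧ b) ≡ 𝟙 a * 𝟙 b
𝟙-∧ true  b = sym (ℚₚ.*-identityˡ (𝟙 b))
𝟙-∧ false b = sym (ℚₚ.*-zeroˡ (𝟙 b))

𝟙-mono : ∀ {a b} → (a ≡ true → b ≡ true) → 𝟙 a ≤ℚ 𝟙 b
𝟙-mono {true}  {b} a⇒b = ≤-reflexive (cong 𝟙 (sym (a⇒b refl)))
𝟙-mono {false} {b} _   = 𝟙-nonNeg b

𝟙-not-∧ : ∀ a b → 𝟙 (not (a ∧ b)) ≤ℚ 𝟙 (not a) + 𝟙 (not b)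
𝟙-not-∧ true  b = ≤-reflexive (sym (ℚₚ.+-identityˡ _))
𝟙-not-∧ false b = subst (_≤ℚ 1ℚ + 𝟙 (not b)) (ℚₚ.+-identityʳ 1ℚ) (ℚₚ.+-monoʳ-≤ 1ℚ (𝟙-nonNeg (not b)))

-- Quantification over lists

allᵇ⁺ : (p : A → Bool) → ∀ xs → (∀ {x} → x ∈ₗ xs → p x ≡ true) → allᵇ p xs ≡ true
allᵇ⁺ p []       _ = refl
allᵇ⁺ p (x ∷ xs) h = cong₂ _∧_ (h (here refl)) (allᵇ⁺ p xs (h ∘ there))

allᵇ⁻ : (p : A → Bool) → ∀ {x xs} → allᵇ p xs ≡ true → x ∈ₗ xs → p x ≡ true
allᵇ⁻ p {xs = y ∷ _} eq x∈ with p y in py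
allᵇ⁻ p eq (here refl)  | true = py
allᵇ⁻ p eq (there x∈xs) | true = allᵇ⁻ p eq x∈xs

allᵇ-cong : ∀ {p q : A → Bool} xs → (∀ {x} → x ∈ₗ xs → p x ≡ q x) → allᵇ p xs ≡ allᵇ q xs
allᵇ-cong []       _ = refl
allᵇ-cong (x ∷ xs) h = cong₂ _∧_ (h (here refl)) (allᵇ-cong xs (h ∘ there))

¬allᵇ⇒∃ : (p : A → Bool) → ∀ xs → allᵇ (not ∘ p) xs ≡ false → ∃[ x ] (x ∈ₗ xs × p x ≡ true)
¬allᵇ⇒∃ p (x ∷ xs) eq with p x in px
... | true  = x , here refl , px
... | false with y , y∈xs , py ← ¬allᵇ⇒∃ p xs eq = y , there y∈xs , py

-- Fair coins indexed by a list of subsets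

_[_≔_] : Family n → Subset n → Bool → Family n
(ω [ s ≔ b ]) t = if ≡ᵇ t s then b else ω t

≔-same : (ω : Family n) → ∀ s b → (ω [ s ≔ b ]) s ≡ b
≔-same ω s b = cong (λ c → if c then b else ω s) (dec-true (s ≟ₛ s) refl)

≔-other : (ω : Family n) → ∀ {s t} b → t ≢ s → (ω [ s ≔ b ]) t ≡ ω t
≔-other ω {s} {t} b t≢s = cong (λ c → if c then b else ω t) (dec-false (t ≟ₛ s) t≢s)

-- The average over all outcomes of the coins in `L`, with tails everywhere else. The head `s`
-- overwrites what the rest of the list produced, so for a repeated subset the first entry decides.
𝔼 : List (Subset n) → (Family n → ℚ) → ℚ
𝔼 []      g = g (λ _ → false)
𝔼 (s ∷ L) g = ½ * (𝔼 L (λ ω → g (ω [ s ≔ false ])) + 𝔼 L (λ ω → g (ω [ s ≔ true ])))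

½-average : ∀ x → ½ * (x + x) ≡ x
½-average = solve 1 (λ x → con ½ :* (x :+ x) := x) refl

𝔼-mono : ∀ (L : List (Subset n)) {g h} → (∀ ω → g ω ≤ℚ h ω) → 𝔼 L g ≤ℚ 𝔼 L h
𝔼-mono []      g≤h = g≤h _
𝔼-mono (s ∷ L) g≤h =
  *-monoˡ 0≤½ (ℚₚ.+-mono-≤ (𝔼-mono L λ ω → g≤h _) (𝔼-mono L λ ω → g≤h _))

𝔼-cong : ∀ (L : List (Subset n)) {g h} → (∀ ω → g ω ≡ h ω) → 𝔼 L g ≡ 𝔼 L h
𝔼-cong []      g≡h = g≡h _
𝔼-cong (s ∷ L) g≡h =
  cong (_*_ ½) (cong₂ _+_ (𝔼-cong L λ ω → g≡h _) (𝔼-cong L λ ω → g≡h _))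

𝔼-const : ∀ (L : List (Subset n)) c → 𝔼 L (λ _ → c) ≡ c
𝔼-const []      c = refl
𝔼-const (s ∷ L) c rewrite 𝔼-const L c = ½-average c

𝔼-+ : ∀ (L : List (Subset n)) g h → 𝔼 L (λ ω → g ω + h ω) ≡ 𝔼 L g + 𝔼 L h
𝔼-+ []      g h = refl
𝔼-+ (s ∷ L) g h = trans
  (cong (_*_ ½) (cong₂ _+_ (𝔼-+ L (λ ω → g (ω [ s ≔ false ])) (λ ω → h (ω [ s ≔ false ])))
                           (𝔼-+ L (λ ω → g (ω [ s ≔ true ])) (λ ω → h (ω [ s ≔ true ])))))
  (solve 4 (λ a b c d → con ½ :* ((a :+ b) :+ (c :+ d)) := con ½ :* (a :+ c) :+ con ½ :* (b :+ d)) refl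
    (𝔼 L (λ ω → g (ω [ s ≔ false ]))) _ (𝔼 L (λ ω → g (ω [ s ≔ true ]))) _)

𝔼-sumℚ : ∀ (L : List (Subset n)) (g : A → Family n → ℚ) xs →
         𝔼 L (λ ω → sumℚ (map (λ x → g x ω) xs)) ≡ sumℚ (map (λ x → 𝔼 L (g x)) xs)
𝔼-sumℚ L g []       = 𝔼-const L 0ℚ
𝔼-sumℚ L g (x ∷ xs) = trans (𝔼-+ L (g x) _) (cong (_+_ (𝔼 L (g x))) (𝔼-sumℚ L g xs))

𝔼-complement : ∀ (L : List (Subset n)) (p : Family n → Bool) → 𝔼 L (𝟙 ∘ not ∘ p) ≡ 1ℚ - 𝔼 L (𝟙 ∘ p)
𝔼-complement L p = begin
  a            ≡⟨ solve 2 (λ a b → a := (a :+ b) :- b) refl a b ⟩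
  (a + b) - b  ≡⟨ cong (_- b) (trans (sym (𝔼-+ L _ _)) (trans (𝔼-cong L total) (𝔼-const L 1ℚ))) ⟩
  1ℚ - b       ∎
  where
  open ≡-Reasoning
  a = 𝔼 L (𝟙 ∘ not ∘ p)
  b = 𝔼 L (𝟙 ∘ p)
  total : ∀ ω → 𝟙 (not (p ω)) + 𝟙 (p ω) ≡ 1ℚ
  total ω with p ω
  ... | true  = refl
  ... | false = refl

union-bound : ∀ (L : List (Subset n)) (p : A → Family n → Bool) (b : A → ℚ) xs →
              All (λ x → 𝔼 L (𝟙 ∘ not ∘ p x) ≤ℚ b x) xs →
              𝔼 L (λ ω → 𝟙 (not (allᵇ (λ x → p x ω) xs))) ≤ℚ sumℚ (map b xs)
union-bound L p b []       []          = ≤-reflexive (𝔼-const L 0ℚ)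
union-bound L p b (x ∷ xs) (le ∷ les) = begin
  𝔼 L (λ ω → 𝟙 (not (p x ω ∧ allᵇ (λ y → p y ω) xs)))                    ≤⟨ 𝔼-mono L (λ ω → 𝟙-not-∧ (p x ω) _) ⟩
  𝔼 L (λ ω → 𝟙 (not (p x ω)) + 𝟙 (not (allᵇ (λ y → p y ω) xs)))         ≡⟨ 𝔼-+ L _ _ ⟩
  𝔼 L (𝟙 ∘ not ∘ p x) + 𝔼 L (λ ω → 𝟙 (not (allᵇ (λ y → p y ω) xs)))    ≤⟨ ℚₚ.+-mono-≤ le (union-bound L p b xs les) ⟩
  b x + sumℚ (map b xs)                                                   ∎
  where open ≤-Reasoning

-- Measurability with respect to the coins in `P`. Agreement is pointwise, so the notion also does
-- the work of function extensionality for functions on `Family n`.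
DependsOn : (Subset n → Set) → (Family n → A) → Set
DependsOn P g = ∀ {ω ω′} → (∀ {s} → P s → ω s ≡ ω′ s) → g ω ≡ g ω′

dependsOn-≔ : ∀ {P : Subset n → Set} (g : Family n → A) s b → DependsOn P g → DependsOn P (λ ω → g (ω [ s ≔ b ]))
dependsOn-≔ g s b dep ω≈ω′ = dep λ {t} Pt → cong (if ≡ᵇ t s then b else_) (ω≈ω′ Pt)

≔-ignored : ∀ {P : Subset n → Set} {g : Family n → A} → DependsOn P g →
            ∀ {s} → ¬ P s → ∀ b ω → g (ω [ s ≔ b ]) ≡ g ω
≔-ignored dep ¬Ps b ω = dep λ Pt → ≔-other ω b λ { refl → ¬Ps Pt }

𝔼-ignored : ∀ (L : List (Subset n)) {P g s} → DependsOn P g → ¬ P s → 𝔼 (s ∷ L) g ≡ 𝔼 L g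
𝔼-ignored L dep ¬Ps = trans
  (cong (_*_ ½) (cong₂ _+_ (𝔼-cong L (≔-ignored dep ¬Ps false)) (𝔼-cong L (≔-ignored dep ¬Ps true))))
  (½-average _)

-- Induction on the coin list: each coin lies in `P` or in its complement, so only one factor sees
-- it, and the other can be pulled out of the average over its two sides. `P?` decides which.
𝔼-independent : ∀ (L : List (Subset n)) {P} → Decidable P → ∀ {g h} → DependsOn P g → DependsOn (∁ P) h →
                𝔼 L (λ ω → g ω * h ω) ≡ 𝔼 L g * 𝔼 L h
𝔼-independent []      P? dg dh = refl
𝔼-independent (s ∷ L) {P} P? {g} {h} dg dh = begin
  ½ * (𝔼 L (λ ω → g₀ ω * h₀ ω) + 𝔼 L (λ ω → g₁ ω * h₁ ω))  ≡⟨ cong (_*_ ½) (cong₂ _+_ (split false) (split true)) ⟩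
  ½ * (𝔼 L g₀ * 𝔼 L h₀ + 𝔼 L g₁ * 𝔼 L h₁)                 ≡⟨ combine (P? s) ⟩
  𝔼 (s ∷ L) g * 𝔼 (s ∷ L) h                               ∎
  where
  open ≡-Reasoning
  g₀ h₀ g₁ h₁ : Family _ → ℚ
  g₀ ω = g (ω [ s ≔ false ])
  h₀ ω = h (ω [ s ≔ false ])
  g₁ ω = g (ω [ s ≔ true ])
  h₁ ω = h (ω [ s ≔ true ])
  split : ∀ b → 𝔼 L (λ ω → g (ω [ s ≔ b ]) * h (ω [ s ≔ b ])) ≡
                𝔼 L (λ ω → g (ω [ s ≔ b ])) * 𝔼 L (λ ω → h (ω [ s ≔ b ]))
  split b = 𝔼-independent L P? (dependsOn-≔ g s b dg) (dependsOn-≔ h s b dh)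
  combine : Dec (P s) → ½ * (𝔼 L g₀ * 𝔼 L h₀ + 𝔼 L g₁ * 𝔼 L h₁) ≡ 𝔼 (s ∷ L) g * 𝔼 (s ∷ L) h
  combine (yes Ps) rewrite 𝔼-cong L (≔-ignored dh (λ ¬Ps → ¬Ps Ps) false)
                         | 𝔼-cong L (≔-ignored dh (λ ¬Ps → ¬Ps Ps) true) =
    solve 3 (λ a b c → con ½ :* (a :* c :+ b :* c) := con ½ :* (a :+ b) :* (con ½ :* (c :+ c))) refl
      (𝔼 L g₀) (𝔼 L g₁) (𝔼 L h)
  combine (no ¬Ps) rewrite 𝔼-cong L (≔-ignored dg ¬Ps false)
                         | 𝔼-cong L (≔-ignored dg ¬Ps true) =
    solve 3 (λ a b c → con ½ :* (c :* a :+ c :* b) := con ½ :* (c :+ c) :* (con ½ :* (a :+ b))) refl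
      (𝔼 L h₀) (𝔼 L h₁) (𝔼 L g)

agrees : Family n → List (Subset n) → Family n → Bool
agrees a D ω = allᵇ (λ s → does (ω s Bool.≟ a s)) D

agrees-dependsOn : ∀ {P : Subset n → Set} a {D} → All P D → DependsOn P (agrees a D)
agrees-dependsOn a {D} PD ω≈ω′ =
  allᵇ-cong D λ {s} s∈D → cong (λ b → does (b Bool.≟ a s)) (ω≈ω′ (All.lookup PD s∈D))

agrees⁻ : ∀ (a ω : Family n) {D s} → agrees a D ω ≡ true → s ∈ₗ D → ω s ≡ a s
agrees⁻ a ω {s = s} eq s∈D with ω s Bool.≟ a s | allᵇ⁻ (λ s → does (ω s Bool.≟ a s)) eq s∈D
... | yes p | _ = p

agrees⁺ : ∀ (a ω : Family n) D → (∀ {s} → s ∈ₗ D → ω s ≡ a s) → agrees a D ω ≡ true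
agrees⁺ a ω D ω≈a = allᵇ⁺ _ D λ {s} s∈D → dec-true (ω s Bool.≟ a s) (ω≈a s∈D)

𝔼-coin : ∀ {L : List (Subset n)} {s} b → s ∈ₗ L → 𝔼 L (λ ω → 𝟙 (does (ω s Bool.≟ b))) ≡ ½
-- The case split is on `t ≡ s` rather than on the membership proof: `t` may occur again later in
-- the list, yet its first occurrence is the one that counts.
𝔼-coin {L = s ∷ L} {t} b t∈ = go (t ≟ₛ s) t∈
  where
  value : ∀ c → 𝔼 L (λ ω → 𝟙 (does ((ω [ s ≔ c ]) s Bool.≟ b))) ≡ 𝟙 (does (c Bool.≟ b))
  value c = trans (𝔼-cong L λ ω → cong (λ d → 𝟙 (does (d Bool.≟ b))) (≔-same ω s c)) (𝔼-const L _)
  fair : ∀ b → ½ * (𝟙 (does (false Bool.≟ b)) + 𝟙 (does (true Bool.≟ b))) ≡ ½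
  fair true  = refl
  fair false = refl
  go : Dec (t ≡ s) → t ∈ₗ s ∷ L → 𝔼 (s ∷ L) (λ ω → 𝟙 (does (ω t Bool.≟ b))) ≡ ½
  go (yes refl) _           = trans (cong (_*_ ½) (cong₂ _+_ (value false) (value true))) (fair b)
  go (no t≢s)   (here t≡s)  = ⊥-elim (t≢s t≡s)
  go (no t≢s)   (there t∈L) = trans
    (𝔼-ignored L {P = _≡ t} (λ ω≈ω′ → cong (λ d → 𝟙 (does (d Bool.≟ b))) (ω≈ω′ refl)) (t≢s ∘ sym))
    (𝔼-coin b t∈L)

-- Distinctness of `D` makes the coin at `s` independent of the coins on the remaining entries, so
-- each entry contributes one factor `½`.
𝔼-agrees : ∀ (L : List (Subset n)) (a : Family n) {D} → Unique D → (∀ {s} → s ∈ₗ D → s ∈ₗ L) →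
           𝔼 L (𝟙 ∘ agrees a D) ≡ half^ (length D)
𝔼-agrees L a {[]}    []         D⊆L = 𝔼-const L 1ℚ
𝔼-agrees L a {s ∷ D} (s∉D ∷ uD) D⊆L = begin
  𝔼 L (λ ω → 𝟙 (does (ω s Bool.≟ a s) ∧ agrees a D ω))
    ≡⟨ 𝔼-cong L (λ ω → 𝟙-∧ (does (ω s Bool.≟ a s)) _) ⟩
  𝔼 L (λ ω → 𝟙 (does (ω s Bool.≟ a s)) * 𝟙 (agrees a D ω))
    ≡⟨ 𝔼-independent L (_≟ₛ s) at-s off-s ⟩
  𝔼 L (λ ω → 𝟙 (does (ω s Bool.≟ a s))) * 𝔼 L (𝟙 ∘ agrees a D)
    ≡⟨ cong₂ _*_ (𝔼-coin (a s) (D⊆L (here refl))) (𝔼-agrees L a uD (D⊆L ∘ there)) ⟩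
  ½ * half^ (length D)
    ∎
  where
  open ≡-Reasoning
  at-s : DependsOn (_≡ s) (λ ω → 𝟙 (does (ω s Bool.≟ a s)))
  at-s ω≈ω′ = cong (λ b → 𝟙 (does (b Bool.≟ a s))) (ω≈ω′ refl)
  off-s : DependsOn (∁ (_≡ s)) (𝟙 ∘ agrees a D)
  off-s ω≈ω′ = cong 𝟙 (agrees-dependsOn a (All.map (_∘ sym) s∉D) ω≈ω′)

-- Subsets of a finite set

nonemptyᵇ⁺ : {σ : Subset n} → Nonempty σ → nonemptyᵇ σ ≡ true
nonemptyᵇ⁺ {σ = true  ∷ σ} _                   = refl
nonemptyᵇ⁺ {σ = false ∷ σ} (suc v , there v∈σ) = nonemptyᵇ⁺ (v , v∈σ)

nonemptyᵇ⁻ : {σ : Subset n} → nonemptyᵇ σ ≡ true → Nonempty σ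
nonemptyᵇ⁻ {σ = true  ∷ σ} _  = zero , here
nonemptyᵇ⁻ {σ = false ∷ σ} eq with v , v∈σ ← nonemptyᵇ⁻ {σ = σ} eq = suc v , there v∈σ

⊆ᵇ⁺ : {σ τ : Subset n} → σ ⊆ₛ τ → ⊆ᵇ σ τ ≡ true
⊆ᵇ⁺ {σ = []}        {[]}        σ⊆τ = refl
⊆ᵇ⁺ {σ = false ∷ _} {_ ∷ _}     σ⊆τ = ⊆ᵇ⁺ (Subsetₚ.drop-∷-⊆ σ⊆τ)
⊆ᵇ⁺ {σ = true ∷ _}  {true ∷ _}  σ⊆τ = ⊆ᵇ⁺ (Subsetₚ.drop-∷-⊆ σ⊆τ)
⊆ᵇ⁺ {σ = true ∷ _}  {false ∷ _} σ⊆τ with () ← σ⊆τ here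

⊆ᵇ⁻ : {σ τ : Subset n} → ⊆ᵇ σ τ ≡ true → σ ⊆ₛ τ
⊆ᵇ⁻ {σ = true ∷ _}  {true ∷ _} eq here        = here
⊆ᵇ⁻ {σ = true ∷ _}  {true ∷ _} eq (there v∈σ) = there (⊆ᵇ⁻ eq v∈σ)
⊆ᵇ⁻ {σ = false ∷ _} {_ ∷ _}    eq (there v∈σ) = there (⊆ᵇ⁻ eq v∈σ)

subsetsOf : Subset n → List (Subset n)
subsetsOf []          = [] ∷ []
subsetsOf (false ∷ U) = map (false ∷_) (subsetsOf U)
subsetsOf (true  ∷ U) = map (false ∷_) (subsetsOf U) ++ map (true ∷_) (subsetsOf U)

∈-subsetsOf⁺ : ∀ (U : Subset n) {σ} → σ ⊆ₛ U → σ ∈ₗ subsetsOf U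
∈-subsetsOf⁺ []          {[]}        σ⊆U = here refl
∈-subsetsOf⁺ (false ∷ U) {false ∷ σ} σ⊆U = ∈-map⁺ _ (∈-subsetsOf⁺ U (Subsetₚ.drop-∷-⊆ σ⊆U))
∈-subsetsOf⁺ (false ∷ U) {true ∷ σ}  σ⊆U with () ← σ⊆U here
∈-subsetsOf⁺ (true ∷ U)  {false ∷ σ} σ⊆U = ∈-++⁺ˡ (∈-map⁺ _ (∈-subsetsOf⁺ U (Subsetₚ.drop-∷-⊆ σ⊆U)))
∈-subsetsOf⁺ (true ∷ U)  {true ∷ σ}  σ⊆U =
  ∈-++⁺ʳ (map (false ∷_) (subsetsOf U)) (∈-map⁺ _ (∈-subsetsOf⁺ U (Subsetₚ.drop-∷-⊆ σ⊆U)))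

∈-subsetsOf⁻ : ∀ (U : Subset n) {σ} → σ ∈ₗ subsetsOf U → σ ⊆ₛ U
∈-subsetsOf⁻ []          (here refl) = id
∈-subsetsOf⁻ (false ∷ U) σ∈ with _ , σ∈U , refl ← ∈-map⁻ _ σ∈ = Subsetₚ.out⊆ (∈-subsetsOf⁻ U σ∈U)
∈-subsetsOf⁻ (true ∷ U)  σ∈ with ∈-++⁻ (map (false ∷_) (subsetsOf U)) σ∈
... | inj₁ σ∈₀ with _ , σ∈U , refl ← ∈-map⁻ _ σ∈₀ = Subsetₚ.out⊆ (∈-subsetsOf⁻ U σ∈U)
... | inj₂ σ∈₁ with _ , σ∈U , refl ← ∈-map⁻ _ σ∈₁ = Subsetₚ.in⊆in (∈-subsetsOf⁻ U σ∈U)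

subsetsOf-unique : (U : Subset n) → Unique (subsetsOf U)
subsetsOf-unique []          = [] ∷ []
subsetsOf-unique (false ∷ U) = Uniqueₚ.map⁺ ∷-injectiveʳ (subsetsOf-unique U)
subsetsOf-unique (true ∷ U)  = Uniqueₚ.++⁺
  (Uniqueₚ.map⁺ ∷-injectiveʳ (subsetsOf-unique U)) (Uniqueₚ.map⁺ ∷-injectiveʳ (subsetsOf-unique U))
  λ (σ∈₀ , σ∈₁) → disjoint (∈-map⁻ _ σ∈₀) (∈-map⁻ _ σ∈₁)
  where
  disjoint : ∀ {σ} → ∃[ τ ] (τ ∈ₗ subsetsOf U × σ ≡ false ∷ τ) → ¬ (∃[ τ ] (τ ∈ₗ subsetsOf U × σ ≡ true ∷ τ))
  disjoint (_ , _ , refl) (_ , _ , ())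

length-subsetsOf : (U : Subset n) → length (subsetsOf U) ≡ 2 ℕ.^ ∣ U ∣
length-subsetsOf []          = refl
length-subsetsOf (false ∷ U) = trans (length-map _ (subsetsOf U)) (length-subsetsOf U)
length-subsetsOf (true ∷ U)  = begin
  length (map (false ∷_) L ++ map (true ∷_) L)         ≡⟨ length-++ (map (false ∷_) L) ⟩
  length (map (false ∷_) L) ℕ.+ length (map (true ∷_) L)  ≡⟨ cong₂ ℕ._+_ (length-map _ L) (length-map _ L) ⟩
  length L ℕ.+ length L                                 ≡⟨ cong₂ ℕ._+_ (length-subsetsOf U)
                                                              (trans (length-subsetsOf U) (sym (ℕₚ.+-identityʳ _))) ⟩
  2 ℕ.^ suc ∣ U ∣                                       ∎
  where
  open ≡-Reasoning
  L = subsetsOf U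

-- Carries completeness and absence of repetitions from `subsetsOf` over to the enumeration behind
-- `simplexes`.
allSubsets≡ : ∀ n → allSubsets n ≡ subsetsOf ⊤
allSubsets≡ zero    = refl
allSubsets≡ (suc n) = cong (λ L → map (false ∷_) L ++ map (true ∷_) L) (allSubsets≡ n)

∈-simplexes⁺ : {σ : Subset n} → Nonempty σ → σ ∈ₗ simplexes n
∈-simplexes⁺ {σ = σ} ne = ∈-filter⁺ (λ σ → nonemptyᵇ σ Bool.≟ true)
  (subst (σ ∈ₗ_) (sym (allSubsets≡ _)) (∈-subsetsOf⁺ ⊤ Subsetₚ.⊆⊤)) (nonemptyᵇ⁺ ne)

∈-simplexes⁻ : {σ : Subset n} → σ ∈ₗ simplexes n → Nonempty σ
∈-simplexes⁻ {n = n} σ∈ =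
  nonemptyᵇ⁻ (proj₂ (∈-filter⁻ (λ σ → nonemptyᵇ σ Bool.≟ true) {xs = allSubsets n} σ∈))

simplexes-unique : ∀ n → Unique (simplexes n)
simplexes-unique n = Uniqueₚ.filter⁺ _ (subst Unique (sym (allSubsets≡ n)) (subsetsOf-unique ⊤))

-- Vertices outside a set and sets of bounded size

nonMembers : Subset n → List (Fin n)
nonMembers []          = []
nonMembers (false ∷ U) = zero ∷ map suc (nonMembers U)
nonMembers (true  ∷ U) = map suc (nonMembers U)

∈-nonMembers⁻ : ∀ (U : Subset n) {v} → v ∈ₗ nonMembers U → v ∉ U
∈-nonMembers⁻ (false ∷ U) (here refl) ()
∈-nonMembers⁻ (false ∷ U) (there v∈) v∈U with _ , w∈ , refl ← ∈-map⁻ suc v∈ =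
  ∈-nonMembers⁻ U w∈ (Subsetₚ.drop-there v∈U)
∈-nonMembers⁻ (true ∷ U)  v∈ v∈U with _ , w∈ , refl ← ∈-map⁻ suc v∈ =
  ∈-nonMembers⁻ U w∈ (Subsetₚ.drop-there v∈U)

nonMembers-unique : (U : Subset n) → Unique (nonMembers U)
nonMembers-unique []          = []
nonMembers-unique (false ∷ U) =
  All.tabulate (λ v∈ 0≡v → zero∉ (∈-map⁻ suc (subst (_∈ₗ map suc (nonMembers U)) (sym 0≡v) v∈))) ∷
  Uniqueₚ.map⁺ suc-injective (nonMembers-unique U)
  where
  zero∉ : ¬ (∃[ w ] (w ∈ₗ nonMembers U × zero ≡ suc w))
  zero∉ (_ , _ , ())
nonMembers-unique (true ∷ U)  = Uniqueₚ.map⁺ suc-injective (nonMembers-unique U)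

-- The recursion branches on whether the first vertex belongs to the set, just as one factor of
-- `(x + t) ^ suc n` is expanded.
subsetsUpTo : ∀ n → ℕ → List (Subset n)
subsetsUpTo zero    k       = [] ∷ []
subsetsUpTo (suc n) zero    = map (false ∷_) (subsetsUpTo n zero)
subsetsUpTo (suc n) (suc k) = map (false ∷_) (subsetsUpTo n (suc k)) ++ map (true ∷_) (subsetsUpTo n k)

∈-subsetsUpTo⁺ : ∀ k (U : Subset n) → ∣ U ∣ ≤ k → U ∈ₗ subsetsUpTo n k
∈-subsetsUpTo⁺ k       []          _           = here refl
∈-subsetsUpTo⁺ zero    (false ∷ U) ∣U∣≤0       = ∈-map⁺ _ (∈-subsetsUpTo⁺ zero U ∣U∣≤0)
∈-subsetsUpTo⁺ (suc k) (false ∷ U) ∣U∣≤k       = ∈-++⁺ˡ (∈-map⁺ _ (∈-subsetsUpTo⁺ (suc k) U ∣U∣≤k))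
∈-subsetsUpTo⁺ (suc k) (true ∷ U)  (s≤s ∣U∣≤k) = ∈-++⁺ʳ _ (∈-map⁺ _ (∈-subsetsUpTo⁺ k U ∣U∣≤k))

∈-subsetsUpTo⁻ : ∀ n k {U : Subset n} → U ∈ₗ subsetsUpTo n k → ∣ U ∣ ≤ k
∈-subsetsUpTo⁻ zero    k       (here refl) = z≤n
∈-subsetsUpTo⁻ (suc n) zero    U∈ with _ , V∈ , refl ← ∈-map⁻ _ U∈ = ∈-subsetsUpTo⁻ n zero V∈
∈-subsetsUpTo⁻ (suc n) (suc k) U∈ with ∈-++⁻ (map (false ∷_) (subsetsUpTo n (suc k))) U∈
... | inj₁ U∈₀ with _ , V∈ , refl ← ∈-map⁻ _ U∈₀ = ∈-subsetsUpTo⁻ n (suc k) V∈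
... | inj₂ U∈₁ with _ , V∈ , refl ← ∈-map⁻ _ U∈₁ = s≤s (∈-subsetsUpTo⁻ n k V∈)

-- Every member of U costs a factor t and every other vertex a factor x, so the sum over all U,
-- without the size restriction, would be exactly (x + t) ^ n.
sum-over-subsetsUpTo : ∀ {x t} → 0ℚ ≤ℚ x → 0ℚ ≤ℚ t → t ≤ℚ 1ℚ → ∀ n k →
  t ^ k * sumℚ (map (λ U → x ^ length (nonMembers U)) (subsetsUpTo n k)) ≤ℚ (x + t) ^ n
sum-over-subsetsUpTo {x} {t} 0≤x 0≤t t≤1 = bound
  where
  open ≤-Reasoning
  S : ∀ n → List (Subset n) → ℚ
  S n L = sumℚ (map (λ U → x ^ length (nonMembers U)) L)

  S-false : ∀ n L → S (suc n) (map (false ∷_) L) ≡ x * S n L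
  S-false n []      = sym (ℚₚ.*-zeroʳ x)
  S-false n (U ∷ L) = trans
    (cong₂ _+_ (cong (λ l → x * x ^ l) (length-map suc (nonMembers U))) (S-false n L))
    (sym (ℚₚ.*-distribˡ-+ x _ _))

  S-true : ∀ n L → S (suc n) (map (true ∷_) L) ≡ S n L
  S-true n []      = refl
  S-true n (U ∷ L) = cong₂ _+_ (cong (x ^_) (length-map suc (nonMembers U))) (S-true n L)

  0≤x+t : 0ℚ ≤ℚ x + t
  0≤x+t = +-nonNeg 0≤x 0≤t

  bound : ∀ n k → t ^ k * S n (subsetsUpTo n k) ≤ℚ (x + t) ^ n
  bound zero k = ≤-trans (≤-reflexive (trans (cong (_*_ (t ^ k)) (ℚₚ.+-identityʳ 1ℚ)) (ℚₚ.*-identityʳ (t ^ k))))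
                         (^-≤1 0≤t t≤1 k)
  bound (suc n) zero = begin
    1ℚ * S (suc n) (map (false ∷_) L)  ≡⟨ cong (_*_ 1ℚ) (S-false n L) ⟩
    1ℚ * (x * S n L)                   ≡⟨ solve 2 (λ x s → con 1ℚ :* (x :* s) := x :* (con 1ℚ :* s)) refl x (S n L) ⟩
    x * (1ℚ * S n L)                   ≤⟨ *-monoˡ 0≤x (bound n zero) ⟩
    x * (x + t) ^ n                    ≤⟨ *-monoʳ (^-nonNeg 0≤x+t n) x≤x+t ⟩
    (x + t) * (x + t) ^ n              ∎
    where
    L = subsetsUpTo n zero
    x≤x+t : x ≤ℚ x + t
    x≤x+t = subst (_≤ℚ x + t) (ℚₚ.+-identityʳ x) (ℚₚ.+-monoʳ-≤ x 0≤t)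
  -- If the first vertex lies in the set, it takes one factor `t` out of `t ^ suc k` and the size
  -- budget drops to `k`; if not, it takes a factor `x` and the budget stays.
  bound (suc n) (suc k) = begin
    t * t ^ k * S (suc n) (map (false ∷_) L₀ ++ map (true ∷_) L₁)
      ≡⟨ cong (_*_ (t * t ^ k)) splitting ⟩
    t * t ^ k * (x * S n L₀ + S n L₁)
      ≡⟨ solve 5 (λ t u x a b → t :* u :* (x :* a :+ b) := x :* (t :* u :* a) :+ t :* (u :* b))
           refl t (t ^ k) x (S n L₀) (S n L₁) ⟩
    x * (t * t ^ k * S n L₀) + t * (t ^ k * S n L₁)
      ≤⟨ ℚₚ.+-mono-≤ (*-monoˡ 0≤x (bound n (suc k))) (*-monoˡ 0≤t (bound n k)) ⟩
    x * (x + t) ^ n + t * (x + t) ^ n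
      ≡⟨ sym (ℚₚ.*-distribʳ-+ ((x + t) ^ n) x t) ⟩
    (x + t) * (x + t) ^ n
      ∎
    where
    L₀ = subsetsUpTo n (suc k)
    L₁ = subsetsUpTo n k
    splitting : S (suc n) (map (false ∷_) L₀ ++ map (true ∷_) L₁) ≡ x * S n L₀ + S n L₁
    splitting = trans (cong sumℚ (map-++ _ (map (false ∷_) L₀) _))
      (trans (sumℚ-++ (map _ (map (false ∷_) L₀)) _) (cong₂ _+_ (S-false n L₀) (S-true n L₁)))

-- Adding and deleting a vertex

v∉σ-v : ∀ v (σ : Subset n) → v ∉ σ Subset.- v
v∉σ-v zero    (b ∷ σ) ()
v∉σ-v (suc v) (b ∷ σ) (there v∈) = v∉σ-v v σ v∈

[σ∪v]-v≡σ : ∀ v (σ : Subset n) → v ∉ σ → (σ ∪ ⁅ v ⁆) Subset.- v ≡ σ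
[σ∪v]-v≡σ zero    (true ∷ σ)  v∉σ = ⊥-elim (v∉σ here)
[σ∪v]-v≡σ zero    (false ∷ σ) v∉σ = cong (false ∷_) (trans (Subsetₚ.p─⊥≡p _) (Subsetₚ.∪-identityʳ σ))
[σ∪v]-v≡σ (suc v) (b ∷ σ)     v∉σ = cong₂ _∷_ (∨-identityʳ b) ([σ∪v]-v≡σ v σ (v∉σ ∘ there))

[σ-v]∪v≡σ : ∀ {v} {σ : Subset n} → v ∈ σ → (σ Subset.- v) ∪ ⁅ v ⁆ ≡ σ
[σ-v]∪v≡σ {v = zero}  {true ∷ σ} here        = cong (true ∷_) (trans (Subsetₚ.∪-identityʳ _) (Subsetₚ.p─⊥≡p σ))
[σ-v]∪v≡σ {v = suc v} {b ∷ σ}    (there v∈σ) = cong₂ _∷_ (∨-identityʳ b) ([σ-v]∪v≡σ v∈σ)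

σ⊆τ∪v⇒σ-v⊆τ : ∀ {v} {σ τ : Subset n} → σ ⊆ₛ τ ∪ ⁅ v ⁆ → σ Subset.- v ⊆ₛ τ
σ⊆τ∪v⇒σ-v⊆τ {v = v} {σ} {τ} σ⊆ {w} w∈ with Subsetₚ.x∈p∪q⁻ τ ⁅ v ⁆ (σ⊆ (Subsetₚ.p─q⊆p σ ⁅ v ⁆ w∈))
... | inj₁ w∈τ = w∈τ
... | inj₂ w∈v with refl ← Subsetₚ.x∈⁅y⁆⇒x≡y v w∈v = ⊥-elim (v∉σ-v v σ w∈)

v∈σ∪v : ∀ v (σ : Subset n) → v ∈ σ ∪ ⁅ v ⁆
v∈σ∪v v σ = Subsetₚ.q⊆p∪q σ ⁅ v ⁆ (Subsetₚ.x∈⁅x⁆ v)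

-- Listed representatives of families

restriction : ∀ (D : List (Subset n)) (ω : Family n) → ∃[ f ] (f ∈ₗ familiesOn D ×
              (∀ {s} → s ∈ₗ D → f s ≡ ω s) × (∀ {s} → s ∉ₗ D → f s ≡ false))
restriction []      ω = (λ _ → false) , here refl , (λ ()) , (λ _ → refl)
restriction (s ∷ D) ω with restriction D ω | ω s in ωs
... | f , f∈ , on , off | true =
  f [ s ≔ true ] , ∈-concatMap⁺ _ (lose f∈ (there (here refl))) , on′ , off′
  where
  on′ : ∀ {t} → t ∈ₗ s ∷ D → (f [ s ≔ true ]) t ≡ ω t
  on′ {t} t∈ with t ≟ₛ s | t∈
  ... | yes refl | _         = sym ωs
  ... | no t≢s   | here t≡s  = ⊥-elim (t≢s t≡s)
  ... | no t≢s   | there t∈D = on t∈D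
  off′ : ∀ {t} → t ∉ₗ s ∷ D → (f [ s ≔ true ]) t ≡ false
  off′ {t} t∉ = trans (≔-other f true (t∉ ∘ here)) (off (t∉ ∘ there))
... | f , f∈ , on , off | false =
  f , ∈-concatMap⁺ _ (lose f∈ (here refl)) , on′ , off ∘ (_∘ there)
  where
  on′ : ∀ {t} → t ∈ₗ s ∷ D → f t ≡ ω t
  on′ (there t∈D) = on t∈D
  -- `D` may contain `s` again. If it does, the value comes from the induction hypothesis; if not,
  -- the default `false` outside `D` is the required value of `ω s`.
  on′ (here refl) with Any.any? (s ≟ₛ_) D
  ... | yes s∈D = on s∈D
  ... | no  s∉D = trans (off s∉D) (sym ωs)

-- Each entry of `D` doubles the list, so `familiesOn D` has `2 ^ length D` entries. Summing a
-- constant expresses this count directly in `ℚ`.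
sum-over-familiesOn : ∀ (D : List (Subset n)) c → half^ (length D) * sumℚ (map (λ _ → c) (familiesOn D)) ≡ c
sum-over-familiesOn []      c = trans (ℚₚ.*-identityˡ _) (ℚₚ.+-identityʳ c)
sum-over-familiesOn (s ∷ D) c = begin
  ½ * half^ (length D) * sumℚ (map (λ _ → c) (concatMap _ (familiesOn D)))
                                          ≡⟨ cong (_*_ (½ * half^ (length D))) (twice (familiesOn D)) ⟩
  ½ * half^ (length D) * (S + S)          ≡⟨ solve 2 (λ h S → con ½ :* h :* (S :+ S) := h :* S) refl (half^ (length D)) S ⟩
  half^ (length D) * S                    ≡⟨ sum-over-familiesOn D c ⟩
  c                                       ∎
  where
  open ≡-Reasoning
  S = sumℚ (map (λ _ → c) (familiesOn D))
  twice : ∀ {f g : Family _ → Family _} xs → sumℚ (map (λ _ → c) (concatMap (λ x → f x ∷ g x ∷ []) xs)) ≡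
          sumℚ (map (λ _ → c) xs) + sumℚ (map (λ _ → c) xs)
  twice []       = refl
  twice (x ∷ xs) = trans (cong (λ s → c + (c + s)) (twice xs))
    (solve 2 (λ c s → c :+ (c :+ (s :+ s)) := (c :+ s) :+ (c :+ s)) refl c _)

-- The largest complex contained in a family

core : Family n → Family n
core {n} ω σ = allᵇ (λ τ → not (⊆ᵇ τ σ) ∨ ω τ) (simplexes n)

core⁻ : ∀ (ω : Family n) {σ τ} → core ω σ ≡ true → Nonempty τ → τ ⊆ₛ σ → ω τ ≡ true
core⁻ ω {σ} {τ} eq ne τ⊆σ = trans (cong (λ b → not b ∨ ω τ) (sym (⊆ᵇ⁺ τ⊆σ)))
  (allᵇ⁻ (λ τ → not (⊆ᵇ τ σ) ∨ ω τ) eq (∈-simplexes⁺ ne))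

core⁺ : ∀ (ω : Family n) {σ} → (∀ τ → Nonempty τ → τ ⊆ₛ σ → ω τ ≡ true) → core ω σ ≡ true
core⁺ ω {σ} h = allᵇ⁺ _ (simplexes _) λ {τ} τ∈ → face τ (∈-simplexes⁻ τ∈)
  where
  face : ∀ τ → Nonempty τ → (not (⊆ᵇ τ σ) ∨ ω τ) ≡ true
  face τ ne with ⊆ᵇ τ σ in τ⊆σ
  ... | true  = h τ ne (⊆ᵇ⁻ τ⊆σ)
  ... | false = refl

core-isComplex : (ω : Family n) → IsComplex (core ω)
core-isComplex ω σ τ ne τ⊆σ σ∈ = core⁺ ω λ ρ neρ ρ⊆τ → core⁻ ω σ∈ neρ (Subsetₚ.⊆-trans ρ⊆τ τ⊆σ)

core-cong : ∀ {ω ω′ : Family n} → (∀ {s} → Nonempty s → ω s ≡ ω′ s) → ∀ σ → core ω σ ≡ core ω′ σ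
core-cong ω≈ω′ σ = allᵇ-cong (simplexes _) λ {τ} τ∈ → cong (not (⊆ᵇ τ σ) ∨_) (ω≈ω′ (∈-simplexes⁻ τ∈))

count-∨ : ∀ (p q : A → Bool) xs → (∀ x → p x ≡ true → q x ≡ false) →
          count (λ x → p x ∨ q x) xs ≡ count p xs ℕ.+ count q xs
count-∨ p q []       disj = refl
count-∨ p q (x ∷ xs) disj with p x in px | q x in qx | count-∨ p q xs disj
... | false | false | ih = ih
... | false | true  | ih = trans (cong suc ih) (sym (ℕₚ.+-suc _ _))
... | true  | false | ih = cong suc ih
... | true  | true  | ih with () ← trans (sym qx) (disj x px)

-- Having core X forces the coins on the faces of X to be heads and those on its minimal
-- non-faces to be tails.
weight-bound : (X : Family n) → 𝔼 (simplexes n) (λ ω → 𝟙 (agrees X (simplexes n) (core ω))) ≤ℚ weight X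
weight-bound {n} X = begin
  𝔼 L (λ ω → 𝟙 (agrees X L (core ω)))  ≤⟨ 𝔼-mono L (λ ω → 𝟙-mono (λ eq → agrees⁺ X ω D (forced ω eq))) ⟩
  𝔼 L (𝟙 ∘ agrees X D)                 ≡⟨ 𝔼-agrees L X (Uniqueₚ.filter⁺ D? (simplexes-unique n))
                                            (proj₁ ∘ ∈-filter⁻ D? {xs = L}) ⟩
  half^ (length D)                      ≡⟨ cong half^ (count-∨ X (isMinimalNonFace X) L disjoint) ⟩
  weight X                              ∎
  where
  open ≤-Reasoning
  L = simplexes n
  -- A single filter by the disjunction lists the forced coins without repetition. A face is never a
  -- minimal non-face, so their number is exactly `H X`.
  D? = λ σ → (X σ ∨ isMinimalNonFace X σ) Bool.≟ true
  D = filter D? (simplexes n)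

  disjoint : ∀ σ → X σ ≡ true → isMinimalNonFace X σ ≡ false
  disjoint σ Xσ rewrite Xσ = refl

  facets-in : ∀ {σ} → allᵇ (λ τ → not (⊆ᵇ τ σ ∧ not (≡ᵇ τ σ)) ∨ X τ) (simplexes n) ≡ true →
              ∀ τ → Nonempty τ → τ ⊆ₛ σ → τ ≢ σ → X τ ≡ true
  facets-in {σ} min τ ne τ⊆σ τ≢σ = trans
    (cong₂ (λ a b → not (a ∧ not b) ∨ X τ) (sym (⊆ᵇ⁺ τ⊆σ)) (sym (dec-false (τ ≟ₛ σ) τ≢σ)))
    (allᵇ⁻ (λ τ → not (⊆ᵇ τ σ ∧ not (≡ᵇ τ σ)) ∨ X τ) min (∈-simplexes⁺ ne))

  forced : ∀ ω → agrees X (simplexes n) (core ω) ≡ true → ∀ {σ} → σ ∈ₗ D → ω σ ≡ X σ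
  forced ω core≈X {σ} σ∈D with ∈-filter⁻ D? {xs = simplexes n} σ∈D
  ... | σ∈ , fe with X σ in Xσ
  ... | true  = core⁻ ω (trans (agrees⁻ X (core ω) core≈X σ∈) Xσ) (∈-simplexes⁻ σ∈) Subsetₚ.⊆-refl
  -- Heads at a minimal non-face `σ` is impossible: its proper faces lie in `X`, hence in `core ω`,
  -- so all faces of `σ` would show heads and `σ` would belong to `core ω`.
  ... | false = ¬-not λ ωσ → contra (trans (sym (core⁺ ω (faces ωσ))) (trans (agrees⁻ X (core ω) core≈X σ∈) Xσ))
    where
    contra : true ≢ false
    contra ()
    faces : ω σ ≡ true → ∀ τ → Nonempty τ → τ ⊆ₛ σ → ω τ ≡ true
    faces ωσ τ ne τ⊆σ with τ ≟ₛ σ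
    ... | yes refl = ωσ
    ... | no τ≢σ   = core⁻ ω (trans (agrees⁻ X (core ω) core≈X (∈-simplexes⁺ ne)) (facets-in fe τ ne τ⊆σ τ≢σ)) ne Subsetₚ.⊆-refl

-- Generic families

cone : Subset n → Fin n → List (Subset n)
cone U v = map (_∪ ⁅ v ⁆) (subsetsOf U)

-- The trace of ω on the simplexes σ ∪ {v} with σ ⊆ U is prescribed by the pattern a.
fits : Subset n → Family n → Fin n → Family n → Bool
fits U a v = agrees (λ τ → a (τ Subset.- v)) (cone U v)

avoided : Subset n → Family n → List (Fin n) → Family n → Bool
avoided U a vs ω = allᵇ (λ v → not (fits U a v ω)) vs

-- Every Boolean pattern on the subsets of `U` is demanded, not just the subcomplexes of `core ω`.
-- The list of conditions therefore does not vary with `ω`, as `union-bound` requires.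
genericOver : Subset n → Family n → Bool
genericOver U ω = allᵇ (λ a → not (avoided U a (nonMembers U) ω)) (familiesOn (subsetsOf U))

generic : ℕ → Family n → Bool
generic {n} r ω = allᵇ (λ U → genericOver U ω) (subsetsUpTo n r)

-- Deleting `v` undoes `_∪ ⁅ v ⁆` on sets that avoid `v`, so the map is injective there.
cone-unique : ∀ {U : Subset n} {v} → v ∉ U → Unique (cone U v)
cone-unique {U = U} {v} v∉U = go (subsetsOf-unique U) (All.tabulate (λ σ∈ → v∉U ∘ ∈-subsetsOf⁻ U σ∈))
  where
  go : ∀ {D} → Unique D → All (v ∉_) D → Unique (map (_∪ ⁅ v ⁆) D)
  go []         []           = []
  go {σ ∷ D} (σ∉D ∷ uD) (v∉σ ∷ v∉D) =
    All.tabulate (λ {ρ} ρ∈ eq → clash (subst (_∈ₗ map (_∪ ⁅ v ⁆) D) (sym eq) ρ∈)) ∷ go uD v∉D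
    where
    clash : ¬ (σ ∪ ⁅ v ⁆ ∈ₗ map (_∪ ⁅ v ⁆) D)
    clash mem with τ , τ∈ , eq ← ∈-map⁻ _ mem = All.lookup σ∉D τ∈
      (trans (sym ([σ∪v]-v≡σ v σ v∉σ)) (trans (cong (Subset._- v) eq) ([σ∪v]-v≡σ v τ (All.lookup v∉D τ∈))))

∈-cone⇒v∈ : ∀ (U : Subset n) v {τ} → τ ∈ₗ cone U v → v ∈ τ
∈-cone⇒v∈ U v τ∈ with σ , _ , refl ← ∈-map⁻ _ τ∈ = v∈σ∪v v σ

-- Together with `∈-cone⇒v∈` this makes the cones over `U` at different vertices disjoint:
-- containing one apex or not sorts their coins.
∈-cone⇒w∉ : ∀ {U : Subset n} {v w τ} → w ∉ U → w ≢ v → τ ∈ₗ cone U v → w ∉ τ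
∈-cone⇒w∉ {U = U} {v} w∉U w≢v τ∈ w∈τ with σ , σ∈ , refl ← ∈-map⁻ _ τ∈ with Subsetₚ.x∈p∪q⁻ σ ⁅ v ⁆ w∈τ
... | inj₁ w∈σ = w∉U (∈-subsetsOf⁻ U σ∈ w∈σ)
... | inj₂ w∈v = w≢v (Subsetₚ.x∈⁅y⁆⇒x≡y v w∈v)

-- There is one coin for each subset of `U`; the empty subset accounts for the coin at `⁅ v ⁆`
-- itself, so the exponent is the full `2 ^ ∣ U ∣`.
𝔼-fits : ∀ {U : Subset n} a {v} → v ∉ U → 𝔼 (simplexes n) (𝟙 ∘ fits U a v) ≡ half^ (2 ℕ.^ ∣ U ∣)
𝔼-fits {n} {U} a {v} v∉U = trans
  (𝔼-agrees (simplexes n) _ (cone-unique v∉U) (λ τ∈ → ∈-simplexes⁺ (v , ∈-cone⇒v∈ U v τ∈)))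
  (cong half^ (trans (length-map _ (subsetsOf U)) (length-subsetsOf U)))

fits-dependsOn : ∀ (U : Subset n) a v {P : Subset n → Set} → All P (cone U v) → DependsOn P (fits U a v)
fits-dependsOn U a v = agrees-dependsOn (λ τ → a (τ Subset.- v))

-- The events for distinct v involve disjoint sets of coins, hence are independent.
𝔼-avoided : ∀ {U : Subset n} a {δ} → δ ≤ℚ 1ℚ → δ ≤ℚ half^ (2 ℕ.^ ∣ U ∣) → ∀ {vs} → Unique vs → All (_∉ U) vs →
            𝔼 (simplexes n) (𝟙 ∘ avoided U a vs) ≤ℚ (1ℚ - δ) ^ length vs
𝔼-avoided {n} a δ≤1 δ≤ []         []           = ≤-reflexive (𝔼-const (simplexes n) 1ℚ)
𝔼-avoided {n} {U} a {δ} δ≤1 δ≤ {v ∷ vs} (v∉vs ∷ uvs) (v∉U ∷ vs∉U) = begin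
  𝔼 L (λ ω → 𝟙 (not (fits U a v ω) ∧ avoided U a vs ω))      ≡⟨ 𝔼-cong L (λ ω → 𝟙-∧ (not (fits U a v ω)) _) ⟩
  𝔼 L (λ ω → 𝟙 (not (fits U a v ω)) * 𝟙 (avoided U a vs ω))  ≡⟨ 𝔼-independent L (v ∈?_) through-v off-v ⟩
  𝔼 L (𝟙 ∘ not ∘ fits U a v) * 𝔼 L (𝟙 ∘ avoided U a vs)      ≤⟨ *-monoʳ 0≤rest first ⟩
  (1ℚ - δ) * 𝔼 L (𝟙 ∘ avoided U a vs)                         ≤⟨ *-monoˡ (x≤y⇒0≤y-x δ≤1) (𝔼-avoided {U = U} a δ≤1 δ≤ uvs vs∉U) ⟩
  (1ℚ - δ) * (1ℚ - δ) ^ length vs                             ∎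
  where
  open ≤-Reasoning
  L = simplexes n
  through-v : DependsOn (v ∈_) (𝟙 ∘ not ∘ fits U a v)
  through-v ω≈ω′ = cong (𝟙 ∘ not) (fits-dependsOn U a v (All.tabulate (∈-cone⇒v∈ U v)) ω≈ω′)
  off-v : DependsOn (∁ (v ∈_)) (𝟙 ∘ avoided U a vs)
  off-v ω≈ω′ = cong 𝟙 (allᵇ-cong vs λ {w} w∈ →
    cong not (fits-dependsOn U a w (All.tabulate (∈-cone⇒w∉ v∉U (All.lookup v∉vs w∈))) ω≈ω′))
  0≤rest : 0ℚ ≤ℚ 𝔼 L (𝟙 ∘ avoided U a vs)
  0≤rest = subst (_≤ℚ 𝔼 L (𝟙 ∘ avoided U a vs)) (𝔼-const L 0ℚ) (𝔼-mono L λ ω → 𝟙-nonNeg (avoided U a vs ω))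
  first : 𝔼 L (𝟙 ∘ not ∘ fits U a v) ≤ℚ 1ℚ - δ
  first = ≤-trans
    (≤-reflexive (trans (𝔼-complement L (fits U a v)) (cong (_-_ 1ℚ) (𝔼-fits a v∉U))))
    (ℚₚ.+-monoʳ-≤ 1ℚ (ℚₚ.neg-antimono-≤ δ≤))

-- Every set in a cone contains its apex, so `generic` never reads the coin at the empty set, and a
-- family may be exchanged for a listed one that agrees with it on the simplexes.
generic-cong : ∀ r {ω ω′ : Family n} → (∀ {s} → Nonempty s → ω s ≡ ω′ s) → generic r ω ≡ generic r ω′
generic-cong r ω≈ω′ =
  allᵇ-cong (subsetsUpTo _ r) λ {U} _ → allᵇ-cong (familiesOn (subsetsOf U)) λ {a} _ → cong not
  (allᵇ-cong (nonMembers U) λ {v} _ → cong not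
  (fits-dependsOn U a v (All.tabulate λ τ∈ → v , ∈-cone⇒v∈ U v τ∈) ω≈ω′))

-- The constants stand on the left to avoid division: `δ` absorbs the number of patterns for one
-- `U`, and `(½ * δ) ^ r` absorbs the choice of `U`.
𝔼-nongeneric : ∀ n r → let δ = half^ (2 ℕ.^ r) in
               δ * (½ * δ) ^ r * 𝔼 (simplexes n) (𝟙 ∘ not ∘ generic r) ≤ℚ (1ℚ - ½ * δ) ^ n
𝔼-nongeneric n r = begin
  δ * θ ^ r * 𝔼 L (𝟙 ∘ not ∘ generic r)   ≤⟨ *-monoˡ (*-nonNeg 0≤δ 0≤θ^r) 
                                               (union-bound L genericOver b Us (All.tabulate λ {U} U∈ → bad-U {U} (small U∈))) ⟩
  δ * θ ^ r * sumℚ (map b Us)             ≡⟨ solve 3 (λ δ t s → δ :* t :* s := t :* (δ :* s)) refl δ (θ ^ r) (sumℚ (map b Us)) ⟩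
  θ ^ r * (δ * sumℚ (map b Us))           ≡⟨ cong (_*_ (θ ^ r)) (sym (sumℚ-*ˡ δ b Us)) ⟩
  θ ^ r * sumℚ (map (λ U → δ * b U) Us)   ≤⟨ *-monoˡ 0≤θ^r (sumℚ-mono (λ U → δ * b U) c Us (All.tabulate λ {U} U∈ → δ*b≤ {U} (small U∈))) ⟩
  θ ^ r * sumℚ (map c Us)                 ≤⟨ sum-over-subsetsUpTo 0≤1-δ 0≤θ θ≤1 n r ⟩
  (1ℚ - δ + θ) ^ n                        ≡⟨ cong (_^ n)
                                               (solve 1 (λ δ → con 1ℚ :- δ :+ con ½ :* δ := con 1ℚ :- con ½ :* δ) refl δ) ⟩
  (1ℚ - θ) ^ n                            ∎
  where
  open ≤-Reasoning
  L = simplexes n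
  Us = subsetsUpTo n r
  δ = half^ (2 ℕ.^ r)
  θ = ½ * δ
  0≤δ = half^-nonNeg (2 ℕ.^ r)
  0≤θ = half^-nonNeg (suc (2 ℕ.^ r))
  θ≤1 = half^-≤1 (suc (2 ℕ.^ r))
  0≤θ^r = ^-nonNeg 0≤θ r
  0≤1-δ = x≤y⇒0≤y-x (half^-≤1 (2 ℕ.^ r))
  c b : Subset n → ℚ
  c U = (1ℚ - δ) ^ length (nonMembers U)
  b U = sumℚ (map (λ _ → c U) (familiesOn (subsetsOf U)))

  small : ∀ {U} → U ∈ₗ Us → δ ≤ℚ half^ (2 ℕ.^ ∣ U ∣)
  small U∈ = half^-antimono (ℕₚ.^-monoʳ-≤ 2 (∈-subsetsUpTo⁻ n r U∈))

  bad-pattern : ∀ {U} → δ ≤ℚ half^ (2 ℕ.^ ∣ U ∣) → ∀ a →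
                𝔼 L (𝟙 ∘ not ∘ not ∘ avoided U a (nonMembers U)) ≤ℚ c U
  bad-pattern {U} δ≤ a = subst (_≤ℚ c U) (𝔼-cong L λ ω → cong 𝟙 (sym (not-involutive (avoided U a (nonMembers U) ω))))
    (𝔼-avoided {U = U} a (half^-≤1 (2 ℕ.^ r)) δ≤ (nonMembers-unique U) (All.tabulate (∈-nonMembers⁻ U)))

  bad-U : ∀ {U} → δ ≤ℚ half^ (2 ℕ.^ ∣ U ∣) →
          𝔼 L (𝟙 ∘ not ∘ genericOver U) ≤ℚ b U
  bad-U {U} δ≤ = union-bound L (λ a → not ∘ avoided U a (nonMembers U)) (λ _ → c U) (familiesOn (subsetsOf U))
    (All.tabulate λ {a} _ → bad-pattern {U} δ≤ a)

  δ*b≤ : ∀ {U} → δ ≤ℚ half^ (2 ℕ.^ ∣ U ∣) → δ * b U ≤ℚ c U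
  δ*b≤ {U} δ≤ = begin
    δ * b U                             ≤⟨ *-monoʳ (sumℚ-nonNeg _ (λ _ → ^-nonNeg 0≤1-δ (length (nonMembers U)))
                                                               (familiesOn (subsetsOf U))) δ≤ ⟩
    half^ (2 ℕ.^ ∣ U ∣) * b U           ≡⟨ cong (λ l → half^ l * b U) (sym (length-subsetsOf U)) ⟩
    half^ (length (subsetsOf U)) * b U  ≡⟨ sum-over-familiesOn (subsetsOf U) (c U) ⟩
    c U                                 ∎

-- Ampleness of generic complexes

generic⇒cone-point : ∀ r {ω : Family n} → generic r ω ≡ true → ∀ U → ∣ U ∣ ≤ r → ∀ (A : Family n) →
  ∃[ v ] (v ∉ U × (∀ {σ} → σ ⊆ₛ U → ω (σ ∪ ⁅ v ⁆) ≡ A σ))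
generic⇒cone-point r {ω} gen U ∣U∣≤r A
  -- `generic` speaks about listed patterns, so `A` is first replaced by the listed pattern with the
  -- same values on the subsets of `U`.
  with a , a∈ , on , _ ← restriction (subsetsOf U) A
  with v , v∈ , fit ← ¬allᵇ⇒∃ (λ v → fits U a v ω) (nonMembers U)
    (trans (sym (not-involutive _)) (cong not (allᵇ⁻ (λ a → not (avoided U a (nonMembers U) ω))
      (allᵇ⁻ (λ U → genericOver U ω) gen (∈-subsetsUpTo⁺ r U ∣U∣≤r)) a∈)))
  with v∉U ← ∈-nonMembers⁻ U v∈
  = v , v∉U , λ {σ} σ⊆U →
      trans (agrees⁻ (λ τ → a (τ Subset.- v)) ω fit (∈-map⁺ _ (∈-subsetsOf⁺ U σ⊆U)))
      (trans (cong a ([σ∪v]-v≡σ v σ (v∉U ∘ σ⊆U))) (on (∈-subsetsOf⁺ U σ⊆U)))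

-- On the empty set the pattern is true, which puts the cone point itself into the complex.
completion : Family n → Family n
completion A σ = not (nonemptyᵇ σ) ∨ A σ

completion-nonempty : ∀ (A : Family n) {σ} → Nonempty σ → completion A σ ≡ A σ
completion-nonempty A ne = cong (λ b → not b ∨ A _) (nonemptyᵇ⁺ ne)

completion⁺ : ∀ (A : Family n) {σ} → (Nonempty σ → A σ ≡ true) → completion A σ ≡ true
completion⁺ A {σ} h with nonemptyᵇ σ in ne
... | true  = h (nonemptyᵇ⁻ ne)
... | false = refl

generic⇒ample : ∀ r {ω X : Family n} → generic r ω ≡ true → (∀ {σ} → Nonempty σ → core ω σ ≡ X σ) →
                IsComplex X × IsAmple r X
generic⇒ample {n} r {ω} {X} gen core≈X = isComplex , (isComplex , nonempty) , extend
  where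
  isComplex : IsComplex X
  isComplex σ τ ne@(v , v∈τ) τ⊆σ σ∈X =
    trans (sym (core≈X ne)) (core-isComplex ω σ τ ne τ⊆σ (trans (core≈X (v , τ⊆σ v∈τ)) σ∈X))

  extend : ∀ U → (∀ u → u ∈ U → u ∈V X) → ∣ U ∣ ≤ r → ∀ (A : Family n) → IsComplex A →
           (∀ σ → Nonempty σ → σ ∈F A → σ ∈Ind[ X , U ]) →
           ∃[ v ] ((v ∈V X) × (v ∉ U) ×
             (∀ σ → Nonempty σ → (σ ∈Lk[ X , v ] × σ ∈Ind[ X , U ]) ⇔ (σ ∈F A)))
  extend U _ ∣U∣≤r A A-complex A⊆ with v , v∉U , fit ← generic⇒cone-point r {ω} gen U ∣U∣≤r (completion A) =
    v , v∈X , v∉U , λ σ ne → mk⇔ (link⇒A ne) (A⇒link ne)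
    where
    -- Membership in `A` is asked of a nonempty `σ` only. This admits the empty set, the case that
    -- makes `v` itself a vertex of `X`.
    coned : ∀ {σ} → σ ⊆ₛ U → (Nonempty σ → A σ ≡ true) → X (σ ∪ ⁅ v ⁆) ≡ true
    coned {σ} σ⊆U Aσ = trans (sym (core≈X (v , v∈σ∪v v σ))) (core⁺ ω face)
      where
      face : ∀ τ → Nonempty τ → τ ⊆ₛ σ ∪ ⁅ v ⁆ → ω τ ≡ true
      face τ ne@(w , w∈τ) τ⊆ with v ∈? τ
      -- A face through `v` shows heads because deleting `v` leaves either the empty set, where
      -- `completion` is true, or a face of `σ`, which is in `A`. A face avoiding `v` is a face of
      -- `σ`, and `σ` is in `X` because `A` is.
      ... | yes v∈τ = trans (cong ω (sym ([σ-v]∪v≡σ v∈τ))) (trans (fit (Subsetₚ.⊆-trans τ-v⊆σ σ⊆U))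
              (completion⁺ A λ ne′@(u , u∈) → A-complex σ _ ne′ τ-v⊆σ (Aσ (u , τ-v⊆σ u∈))))
        where
        τ-v⊆σ : τ Subset.- v ⊆ₛ σ
        τ-v⊆σ = σ⊆τ∪v⇒σ-v⊆τ τ⊆
      ... | no v∉τ = core⁻ ω (trans (core≈X neσ) (proj₁ (A⊆ σ neσ (Aσ neσ)))) ne τ⊆σ
        where
        τ⊆σ : τ ⊆ₛ σ
        τ⊆σ {u} u∈τ with Subsetₚ.x∈p∪q⁻ σ ⁅ v ⁆ (τ⊆ u∈τ)
        ... | inj₁ u∈σ = u∈σ
        ... | inj₂ u∈v with refl ← Subsetₚ.x∈⁅y⁆⇒x≡y v u∈v = ⊥-elim (v∉τ u∈τ)
        neσ : Nonempty σ
        neσ = w , τ⊆σ w∈τ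

    v∈X : v ∈V X
    v∈X = subst (_∈F X) (Subsetₚ.∪-identityˡ ⁅ v ⁆) (coned Subsetₚ.⊥⊆ λ (_ , u∈⊥) → ⊥-elim (Subsetₚ.∉⊥ u∈⊥))

    link⇒A : ∀ {σ} → Nonempty σ → σ ∈Lk[ X , v ] × σ ∈Ind[ X , U ] → σ ∈F A
    link⇒A {σ} ne ((_ , σ∪v∈X) , (_ , σ⊆U)) =
      trans (sym (completion-nonempty A ne)) (trans (sym (fit σ⊆U))
      (core⁻ ω (trans (core≈X ne∪) σ∪v∈X) ne∪ Subsetₚ.⊆-refl))
      where ne∪ = v , v∈σ∪v v σ

    A⇒link : ∀ {σ} → Nonempty σ → σ ∈F A → σ ∈Lk[ X , v ] × σ ∈Ind[ X , U ]
    A⇒link {σ} ne σ∈A with σ∈X , σ⊆U ← A⊆ σ ne σ∈A = (v∉U ∘ σ⊆U , coned σ⊆U (λ _ → σ∈A)) , (σ∈X , σ⊆U)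

  nonempty : ∃[ σ ] (Nonempty σ × σ ∈F X)
  -- Extending the empty vertex set with the empty complex as link produces a vertex of `X`.
  nonempty with v , v∈X , _ ← extend ⊥ (λ _ u∈⊥ → ⊥-elim (Subsetₚ.∉⊥ u∈⊥))
                                 (subst (_≤ r) (sym (Subsetₚ.∣⊥∣≡0 n)) z≤n)
                                 (λ _ → false) (λ _ _ _ _ ()) (λ _ _ ()) =
    ⁅ v ⁆ , (v , Subsetₚ.x∈⁅x⁆ v) , v∈X

-- From coin tosses to the weights of complexes

HasGenericCore : ℕ → Family n → Set
HasGenericCore {n} r X = Any (λ ω → generic r ω ≡ true × agrees X (simplexes n) (core ω) ≡ true) (allFamilies n)

-- Ampleness quantifies over arbitrary functions `A`, whereas this search runs through a finite
-- list. Being decidable, it can cut out a sublist of `allFamilies n` by `filter`.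
hasGenericCore? : ∀ r → Decidable (HasGenericCore {n} r)
hasGenericCore? {n} r X =
  Any.any? (λ ω → (generic r ω Bool.≟ true) ×-dec (agrees X (simplexes n) (core ω) Bool.≟ true)) (allFamilies n)

hasGenericCore⇒ample : ∀ r {X : Family n} → HasGenericCore r X → IsComplex X × IsAmple r X
hasGenericCore⇒ample r {X} core∈ with ω , gen , core≈X ← Any.satisfied core∈ =
  generic⇒ample r {ω} {X} gen (agrees⁻ X (core ω) core≈X ∘ ∈-simplexes⁺)

-- Neither `ω` nor `core ω` need be a listed function. Both are replaced by listed families with the
-- same values on simplexes, and `generic-cong` and `core-cong` carry the properties over.
realised : ∀ r (ω : Family n) → generic r ω ≡ true →
           ∃[ X ] (X ∈ₗ filter (hasGenericCore? r) (allFamilies n) × agrees X (simplexes n) (core ω) ≡ true)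
realised {n} r ω gen
  with X , X∈ , X≈core , _ ← restriction (simplexes n) (core ω)
  with ω′ , ω′∈ , ω′≈ω , _ ← restriction (simplexes n) ω =
  X , ∈-filter⁺ (hasGenericCore? r) X∈ (lose ω′∈
        ( trans (generic-cong r {ω′} {ω} (ω′≈ω ∘ ∈-simplexes⁺)) gen
        , agrees⁺ X (core ω′) (simplexes n) λ {σ} σ∈ →
            trans (core-cong {ω = ω′} {ω′ = ω} (ω′≈ω ∘ ∈-simplexes⁺) σ) (sym (X≈core σ∈))))
    , agrees⁺ X (core ω) (simplexes n) λ σ∈ → sym (X≈core σ∈)

-- Each generic `ω` has its core represented by some `X` in the filtered list, so the indicator of
-- `generic` is at most the sum of the indicators of having core `X`. Expectations of the latter are
-- bounded by `weight-bound`.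
𝔼-generic≤weight : ∀ n r → 𝔼 (simplexes n) (𝟙 ∘ generic r) ≤ℚ
                   sumℚ (map weight (filter (hasGenericCore? r) (allFamilies n)))
𝔼-generic≤weight n r = begin
  𝔼 L (𝟙 ∘ generic r)                            ≤⟨ 𝔼-mono L pointwise ⟩
  𝔼 L (λ ω → sumℚ (map (λ X → hits X ω) S))      ≡⟨ 𝔼-sumℚ L hits S ⟩
  sumℚ (map (λ X → 𝔼 L (hits X)) S)              ≤⟨ sumℚ-mono (λ X → 𝔼 L (hits X)) weight S (All.tabulate λ {X} _ → weight-bound X) ⟩
  sumℚ (map weight S)                            ∎
  where
  open ≤-Reasoning
  L = simplexes n
  S = filter (hasGenericCore? r) (allFamilies n)
  hits : Family n → Family n → ℚ
  hits X ω = 𝟙 (agrees X L (core ω))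
  0≤hits : ∀ ω X → 0ℚ ≤ℚ hits X ω
  0≤hits ω X = 𝟙-nonNeg (agrees X L (core ω))
  pointwise : ∀ ω → 𝟙 (generic r ω) ≤ℚ sumℚ (map (λ X → hits X ω) S)
  pointwise ω with generic r ω in gen
  ... | false = sumℚ-nonNeg (λ X → hits X ω) (0≤hits ω) S
  ... | true with X , X∈S , hit ← realised r ω gen =
    ≤-trans (≤-reflexive (cong 𝟙 (sym hit))) (member≤sumℚ (λ X → hits X ω) (0≤hits ω) X∈S)

nongeneric-rare : ∀ r ε → Positive ε → ∃[ N ] (∀ n → N ≤ n → 𝔼 (simplexes n) (𝟙 ∘ not ∘ generic r) ≤ℚ ε)
nongeneric-rare r ε ε>0 = proj₁ decay , λ n N≤n →
  ℚₚ.*-cancelˡ-≤-pos κ ⦃ κ>0 ⦄ (≤-trans (𝔼-nongeneric n r) (proj₂ decay n N≤n))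
  where
  δ = half^ (2 ℕ.^ r)
  θ = ½ * δ
  κ = δ * θ ^ r
  θ>0 : Positive θ
  θ>0 = half^-pos (suc (2 ℕ.^ r))
  ^-pos : ∀ k → Positive (θ ^ k)
  ^-pos zero    = _
  ^-pos (suc k) = ℚₚ.pos*pos⇒pos θ ⦃ θ>0 ⦄ (θ ^ k) ⦃ ^-pos k ⦄
  κ>0 : Positive κ
  κ>0 = ℚₚ.pos*pos⇒pos δ ⦃ half^-pos (2 ℕ.^ r) ⦄ (θ ^ r) ⦃ ^-pos r ⦄
  -- The target is `κ * ε`, so that cancelling `κ` from the bound of `𝔼-nongeneric` leaves `ε`.
  decay = geometric-decay θ θ>0 (half^-≤1 (suc (2 ℕ.^ r))) (κ * ε) (ℚₚ.pos*pos⇒pos κ ⦃ κ>0 ⦄ ε ⦃ ε>0 ⦄)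

𝔼-generic≥ : ∀ n r {ε} → 𝔼 (simplexes n) (𝟙 ∘ not ∘ generic r) ≤ℚ ε → 1ℚ - ε ≤ℚ 𝔼 (simplexes n) (𝟙 ∘ generic r)
𝔼-generic≥ n r {ε} rare = begin
  1ℚ - ε                                        ≤⟨ ℚₚ.+-monoʳ-≤ 1ℚ (ℚₚ.neg-antimono-≤ rare) ⟩
  1ℚ - 𝔼 (simplexes n) (𝟙 ∘ not ∘ generic r)    ≡⟨ sym (𝔼-complement (simplexes n) (not ∘ generic r)) ⟩
  𝔼 (simplexes n) (𝟙 ∘ not ∘ not ∘ generic r)   ≡⟨ 𝔼-cong (simplexes n) (λ ω → cong 𝟙 (not-involutive (generic r ω))) ⟩
  𝔼 (simplexes n) (𝟙 ∘ generic r)               ∎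
  where open ≤-Reasoning

theorem3p2 : (r : ℕ) → 1 ≤ r →
    (ε : ℚ) → Positive ε →
    ∃[ N ] (∀ (n : ℕ) → N ≤ n →
    ∃[ S ] ((S ⊆ allFamilies n) ×
    All (λ X → IsComplex X × IsAmple r X) S ×
    (1ℚ - ε) ≤ℚ sumℚ (map weight S)))
theorem3p2 r _ ε ε>0 = proj₁ rare , λ n N≤n →
  filter (hasGenericCore? r) (allFamilies n) ,
  filter-⊆ (hasGenericCore? r) (allFamilies n) ,
  All.map (hasGenericCore⇒ample r) (all-filter (hasGenericCore? r) (allFamilies n)) ,
  ≤-trans (𝔼-generic≥ n r (proj₂ rare n N≤n)) (𝔼-generic≤weight n r)
  where rare = nongeneric-rare r ε ε>0
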